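{- Let $G$ be a connected $d$-regular graph of order $n$. Then $G$ is resistance regular if and only if $$\sum_{j\in N(i)}L_{ij}^+=\frac{d}{n^2}\,Kf(G)+\frac1n-1\quad\text{for all } i\in V(G).$$
   Context: All graphs are finite, simple, undirected and connected. A graph is $d$-regular if all vertex degrees equal $d$. $N(i)$ is the set of vertices adjacent to $i$. $L^+$ is the Moore-Penrose inverse of the Laplacian matrix $L=D-A$ of $G$. The resistance distance $r_{ij}$ is the effective resistance between vertices $i$ and $j$ when each edge of $G$ carries a unit resistance; equivalently (known fact) $r_{ij}=L_{ii}^++L_{jj}^+-2L_{ij}^+$. The resistance matrix is $R(G)=(r_{ij})$; $G$ is resistance regular if all row sums of $R(G)$ are equal. The Kirchhoff index is $Kf(G)=\frac12\sum_{i,j\in V(G)}r_{ij}$. -}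

module Defs where

open import Algebra.Bundles using (CommutativeRing)
open import Data.Bool.Base using (if_then_else_)
open import Data.Fin.Base using (Fin)
open import Data.Fin.Properties using (_≟_)
open import Data.Fin.Subset using (Subset; ∣_∣)
open import Data.Integer.Base using (+_)
open import Data.Nat.Base using (ℕ)
open import Data.Product.Base using (∃-syntax; _×_)
open import Data.Rational.Base using (ℚ; 0ℚ; 1ℚ; ½; _+_; _*_; _-_; _/_)
open import Data.Rational.Properties using (+-*-commutativeRing)
open import Data.Vec.Base using (lookup; tabulate)
open import Level using (0ℓ)
open import Relation.Binary.Construct.Closure.ReflexiveTransitive using (Star)
open import Relation.Binary.Core using (Rel)
open import Relation.Binary.Definitions using (Decidable; Symmetric)
open import Relation.Binary.PropositionalEquality.Core using (_≡_)
open import Relation.Nullary.Decidable.Core using (does)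
open import Relation.Nullary.Negation.Core using (¬_)

open import Algebra.Properties.CommutativeMonoid.Sum
  (CommutativeRing.+-commutativeMonoid +-*-commutativeRing) public
  using (sum; sum-syntax)

record Graph (n : ℕ) : Set₁ where
  field
    Adj     : Rel (Fin n) 0ℓ
    _adj?_  : Decidable Adj
    adj-sym : Symmetric Adj
    no-loop : ∀ i → ¬ Adj i i

  N : Fin n → Subset n
  N i = tabulate (λ j → does (i adj? j))

  degree : Fin n → ℕ
  degree i = ∣ N i ∣

open Graph public using (N; degree)

Connected : ∀ {n} → Graph n → Set
Connected G = ∀ i j → Star (Graph.Adj G) i j

Regular : ∀ {n} → ℕ → Graph n → Set
Regular d G = ∀ i → degree G i ≡ d

sumOver : ∀ {n} → Subset n → (Fin n → ℚ) → ℚ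
sumOver {n} S f = ∑[ j < n ] (if lookup S j then f j else 0ℚ)

infixl 10 sumOver-syntax

sumOver-syntax : ∀ {n} → Subset n → (Fin n → ℚ) → ℚ
sumOver-syntax = sumOver

syntax sumOver-syntax S (λ j → x) = ∑[ j ∈ S ] x

Matrix : ℕ → Set
Matrix n = Fin n → Fin n → ℚ

infix  4 _≋_
infixl 7 _⊗_
infix  9 _ᵀ

-- Pointwise, since function extensionality is not available.
_≋_ : ∀ {n} → Matrix n → Matrix n → Set
A ≋ B = ∀ i j → A i j ≡ B i j

_⊗_ : ∀ {n} → Matrix n → Matrix n → Matrix n
_⊗_ {n} A B i j = ∑[ k < n ] (A i k * B k j)

_ᵀ : ∀ {n} → Matrix n → Matrix n
(A ᵀ) i j = A j i

I : ∀ {n} → Matrix n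
I i j = if does (i ≟ j) then 1ℚ else 0ℚ

adjacency : ∀ {n} → Graph n → Matrix n
adjacency G i j = if does (Graph._adj?_ G i j) then 1ℚ else 0ℚ

degreeMatrix : ∀ {n} → Graph n → Matrix n
degreeMatrix G i j = (+ degree G i / 1) * I i j

laplacian : ∀ {n} → Graph n → Matrix n
laplacian G i j = degreeMatrix G i j - adjacency G i j

-- The four Penrose equations, which determine X uniquely from A. For a
-- rational matrix the inverse is rational, and over ℚ, as over ℝ, the
-- conjugate transpose is the transpose.
record IsMoorePenroseInverse {n} (A X : Matrix n) : Set where
  field
    AXA≋A  : A ⊗ X ⊗ A ≋ A
    XAX≋X  : X ⊗ A ⊗ X ≋ X
    AX-sym : (A ⊗ X) ᵀ ≋ A ⊗ X
    XA-sym : (X ⊗ A) ᵀ ≋ X ⊗ A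

-- Every edge has unit resistance, so by Ohm's law the current from k to a
-- neighbour l is v k - v l. Kirchhoff's current law says that the net current
-- out of k is the current injected there: a unit current enters the network
-- at i and leaves it at j.
IsUnitFlowPotential : ∀ {n} → Graph n → Fin n → Fin n → (Fin n → ℚ) → Set
IsUnitFlowPotential G i j v =
  ∀ k → ∑[ l ∈ N G k ] (v k - v l) ≡ I i k - I j k

-- The potential difference v i - v j does not depend on the choice of v, so
-- at most one r satisfies this; in a connected graph exactly one does.
IsEffectiveResistance : ∀ {n} → Graph n → Fin n → Fin n → ℚ → Set
IsEffectiveResistance G i j r =
  ∃[ v ] IsUnitFlowPotential G i j v × r ≡ v i - v j

IsResistanceMatrix : ∀ {n} → Graph n → Matrix n → Set
IsResistanceMatrix G R = ∀ i j → IsEffectiveResistance G i j (R i j)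

-- In the next two definitions R is the resistance matrix of the graph.
ResistanceRegular : ∀ {n} → Matrix n → Set
ResistanceRegular R = ∀ i k → sum (R i) ≡ sum (R k)

kirchhoffIndex : ∀ {n} → Matrix n → ℚ
kirchhoffIndex {n} R = ½ * ∑[ i < n ] ∑[ j < n ] R i j

{-# OPTIONS --safe #-}

-- Write X for L⁺. On a connected graph the maximum principle makes the kernel
-- of L consist of the constants, so XL, and likewise LX, is I - J/n. Hence the
-- rows and columns of X sum to zero, and a unit flow potential from i to j is
-- k ↦ X k i - X k j up to a constant. This gives
--   r i j = X i i + X j j - X i j - X j i,
-- so row i of R sums to n X i i + tr X, and Kf = n tr X. The diagonal of
-- XL = I - J/n reads ∑_{j ∈ N i} X i j = d X i i - 1 + 1/n, so for d ≠ 0 both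
-- sides of the equivalence say that the diagonal of X is constant. If d = 0,
-- then G has a single vertex.
module Submission where

open import Defs
import Algebra.Properties.Group as GroupProperties
import Algebra.Properties.Semiring.Sum as SemiringSum
open import Algebra.Bundles using (CommutativeRing)
open import Data.Bool.Base using (true; false; if_then_else_)
open import Data.Fin.Base using (Fin; zero; suc)
open import Data.Fin.Properties using () renaming (_≟_ to _≟ᶠ_)
open import Data.Fin.Subset using (Subset; ∣_∣)
open import Data.Integer.Base as ℤ using (+_)
import Data.Integer.Properties as ℤ
open import Data.List.Base using (allFin)
import Data.List.Relation.Unary.All as All
open import Data.List.Membership.Propositional.Properties using (∈-allFin)
open import Data.Nat.Base as ℕ using (ℕ; zero; suc; NonZero; _^_)
open import Data.Nat.Properties using (m^n≢0)
import Data.Nat.Properties as ℕ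
open import Data.Product.Base using (_,_)
open import Data.Rational.Base using (ℚ; 0ℚ; 1ℚ; ½; _+_; _*_; _-_; -_; _/_; _≤_; toℚᵘ)
import Data.Rational.Base as ℚ
open import Data.Rational.Properties
open import Data.Rational.Solver using (module +-*-Solver)
import Data.Rational.Unnormalised.Base as ℚᵘ
import Data.Rational.Unnormalised.Properties as ℚᵘ
open import Data.Vec.Base using ([]; _∷_)
open import Data.Vec.Properties using (lookup∘tabulate)
open import Function.Base using (_∘_)
open import Function.Bundles using (_⇔_; mk⇔)
open import Relation.Binary.Bundles using (DecTotalOrder)
open import Relation.Binary.Construct.Closure.ReflexiveTransitive using (Star; ε; _◅_)
open import Relation.Binary.PropositionalEquality
open import Relation.Nullary.Decidable using (does; yes; no; dec-true; does-⇔)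
open import Relation.Nullary.Negation using (contradiction)
open import Data.List.Extrema (DecTotalOrder.totalOrder ≤-decTotalOrder)
  using (argmax; f[xs]≤f[argmax])

open CommutativeRing +-*-commutativeRing using (semiring)
open GroupProperties +-0-group using () renaming (x∙y⁻¹≈ε⇒x≈y to p-q≡0⇒p≡q; ∙-cancelʳ to +-cancelʳ)
open SemiringSum semiring
  using (sum-cong-≗; ∑-distrib-+; ∑-comm; *-distribˡ-sum; *-distribʳ-sum)
open +-*-Solver using (solve; _:+_; _:*_; _:-_; _:=_; con)

-- Arithmetic of rational numbers and fractions.

p≤q⇒0≤q-p : ∀ {p q} → p ≤ q → 0ℚ ≤ q - p
p≤q⇒0≤q-p {p} {q} p≤q = subst (_≤ q - p) (+-inverseʳ p) (+-monoˡ-≤ (- p) p≤q)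

*-cancelˡ-≢0 : ∀ r {p q} → r ≢ 0ℚ → r * p ≡ r * q → p ≡ q
*-cancelˡ-≢0 r {p} {q} r≢0 rp≡rq = begin
  p                   ≡⟨ *-identityˡ p ⟨
  1ℚ * p              ≡⟨ cong (_* p) (*-inverseˡ r) ⟨
  (ℚ.1/ r) * r * p    ≡⟨ *-assoc (ℚ.1/ r) r p ⟩
  (ℚ.1/ r) * (r * p)  ≡⟨ cong ((ℚ.1/ r) *_) rp≡rq ⟩
  (ℚ.1/ r) * (r * q)  ≡⟨ *-assoc (ℚ.1/ r) r q ⟨
  (ℚ.1/ r) * r * q    ≡⟨ cong (_* q) (*-inverseˡ r) ⟩
  1ℚ * q              ≡⟨ *-identityˡ q ⟩
  q                   ∎
  where
  open ≡-Reasoning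
  instance _ = ℚ.≢-nonZero r≢0

fromℕ : ℕ → ℚ
fromℕ n = + n / 1

n/n≡1 : ∀ n .{{_ : NonZero n}} → + n / n ≡ 1ℚ
n/n≡1 (suc n) = fromℚᵘ-cong {ℚᵘ.mkℚᵘ (+ suc n) n} {ℚᵘ.1ℚᵘ} (ℚᵘ.*≡* (ℤ.*-comm (+ suc n) (+ 1)))

-- Fractions in ℚ are stored in lowest terms, so both sides are compared in ℚᵘ, where the product is
-- by definition formed from numerators and denominators.
/-*-/ : ∀ i j m n .{{_ : NonZero m}} .{{_ : NonZero n}} →
        (i / m) * (j / n) ≡ _/_ (i ℤ.* j) (m ℕ.* n) {{ℕ.m*n≢0 m n}}
/-*-/ i j (suc m) (suc n) = toℚᵘ-injective (begin
  toℚᵘ (i / suc m * (j / suc n))            ≈⟨ toℚᵘ-homo-* (i / suc m) (j / suc n) ⟩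
  toℚᵘ (i / suc m) ℚᵘ.* toℚᵘ (j / suc n)    ≈⟨ ℚᵘ.*-cong (toℚᵘ-fromℚᵘ p) (toℚᵘ-fromℚᵘ q) ⟩
  p ℚᵘ.* q                                  ≈⟨ toℚᵘ-fromℚᵘ (p ℚᵘ.* q) ⟨
  toℚᵘ ((i ℤ.* j) / (suc m ℕ.* suc n))      ∎)
  where
  open ℚᵘ.≃-Reasoning
  p = ℚᵘ.mkℚᵘ i m
  q = ℚᵘ.mkℚᵘ j n

fromℕ-suc : ∀ n → fromℕ (suc n) ≡ 1ℚ + fromℕ n
fromℕ-suc n = toℚᵘ-injective (begin
  toℚᵘ (fromℕ (suc n))           ≈⟨ toℚᵘ-fromℚᵘ (ℚᵘ.mkℚᵘ (+ suc n) 0) ⟩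
  ℚᵘ.mkℚᵘ (+ suc n) 0            ≈⟨ ℚᵘ.*≡* (cong (λ k → (+ 1 ℤ.+ k) ℤ.* + 1)
                                    (sym (ℤ.*-identityʳ (+ n)))) ⟩
  ℚᵘ.1ℚᵘ ℚᵘ.+ ℚᵘ.mkℚᵘ (+ n) 0    ≈⟨ ℚᵘ.+-congʳ ℚᵘ.1ℚᵘ (toℚᵘ-fromℚᵘ (ℚᵘ.mkℚᵘ (+ n) 0)) ⟨
  toℚᵘ 1ℚ ℚᵘ.+ toℚᵘ (fromℕ n)    ≈⟨ toℚᵘ-homo-+ 1ℚ (fromℕ n) ⟨
  toℚᵘ (1ℚ + fromℕ n)            ∎)
  where open ℚᵘ.≃-Reasoning

n*1/n≡1 : ∀ n .{{_ : NonZero n}} → fromℕ n * (+ 1 / n) ≡ 1ℚ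
n*1/n≡1 n = begin
  fromℕ n * (+ 1 / n)
    ≡⟨ /-*-/ (+ n) (+ 1) 1 n ⟩
  _/_ (+ n ℤ.* + 1) (1 ℕ.* n) {{ℕ.m*n≢0 1 n}}
    ≡⟨ /-cong {{ℕ.m*n≢0 1 n}} (ℤ.*-identityʳ (+ n)) (ℕ.*-identityˡ n) ⟩
  + n / n
    ≡⟨ n/n≡1 n ⟩
  1ℚ ∎
  where open ≡-Reasoning

d/n²≡d*1/n*1/n : ∀ d n .{{_ : NonZero n}} →
  _/_ (+ d) (n ^ 2) {{m^n≢0 n 2}} ≡ fromℕ d * ((+ 1 / n) * (+ 1 / n))
d/n²≡d*1/n*1/n d n = sym (begin
  fromℕ d * ((+ 1 / n) * (+ 1 / n))
    ≡⟨ cong (fromℕ d *_) (/-*-/ (+ 1) (+ 1) n n) ⟩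
  fromℕ d * _/_ (+ 1) (n ℕ.* n) {{n*n≢0}}
    ≡⟨ /-*-/ (+ d) (+ 1) 1 (n ℕ.* n) {{_}} {{n*n≢0}} ⟩
  _/_ (+ d ℤ.* + 1) (1 ℕ.* (n ℕ.* n)) {{ℕ.m*n≢0 1 (n ℕ.* n) {{_}} {{n*n≢0}}}}
    -- `n ^ 2` unfolds to `n * (n * 1)`, hence the extra factor 1 in the denominator.
    ≡⟨ /-cong {{ℕ.m*n≢0 1 (n ℕ.* n) {{_}} {{n*n≢0}}}} {{m^n≢0 n 2}}
         (ℤ.*-identityʳ (+ d))
         (trans (ℕ.*-identityˡ (n ℕ.* n)) (cong (n ℕ.*_) (sym (ℕ.*-identityʳ n)))) ⟩
  _/_ (+ d) (n ^ 2) {{m^n≢0 n 2}} ∎)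
  where
  open ≡-Reasoning
  n*n≢0 = ℕ.m*n≢0 n n

-- Finite sums of rationals and the identity matrix.

∑-const : ∀ n x → ∑[ i < n ] x ≡ fromℕ n * x
∑-const zero    x = sym (*-zeroˡ x)
∑-const (suc n) x = begin
  x + ∑[ i < n ] x    ≡⟨ cong (λ s → x + s) (∑-const n x) ⟩
  x + fromℕ n * x     ≡⟨ solve 2 (λ m x → x :+ m :* x := (con 1ℚ :+ m) :* x) refl (fromℕ n) x ⟩
  (1ℚ + fromℕ n) * x  ≡⟨ cong (_* x) (fromℕ-suc n) ⟨
  fromℕ (suc n) * x   ∎
  where open ≡-Reasoning

-- Serves twice: to find the entries of the projection onto the constants, and to replace a constant
-- diagonal of `L⁺` by its mean.
constant⇒≡average : ∀ {n} .{{_ : NonZero n}} (f : Fin n → ℚ) x →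
                    (∀ i → f i ≡ x) → x ≡ (+ 1 / n) * sum f
constant⇒≡average {n} f x f≡x = begin
  x                             ≡⟨ *-identityˡ x ⟨
  1ℚ * x                        ≡⟨ cong (_* x) (n*1/n≡1 n) ⟨
  fromℕ n * (+ 1 / n) * x       ≡⟨ solve 3 (λ a b c → a :* b :* c := b :* (a :* c)) refl
                                     (fromℕ n) (+ 1 / n) x ⟩
  (+ 1 / n) * (fromℕ n * x)     ≡⟨ cong ((+ 1 / n) *_) (∑-const n x) ⟨
  (+ 1 / n) * ∑[ i < n ] x      ≡⟨ cong ((+ 1 / n) *_) (sum-cong-≗ f≡x) ⟨
  (+ 1 / n) * sum f             ∎
  where open ≡-Reasoning

∑-distrib-- : ∀ {n} (f g : Fin n → ℚ) →
              ∑[ i < n ] (f i - g i) ≡ sum f - sum g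
∑-distrib-- {zero}  f g = refl
∑-distrib-- {suc n} f g = begin
  f₀ - g₀ + ∑[ i < n ] (f (suc i) - g (suc i))
    ≡⟨ cong (λ s → f₀ - g₀ + s) (∑-distrib-- (f ∘ suc) (g ∘ suc)) ⟩
  f₀ - g₀ + (sum (f ∘ suc) - sum (g ∘ suc))
    ≡⟨ solve 4 (λ a b c d → a :- b :+ (c :- d) := a :+ c :- (b :+ d)) refl
         f₀ g₀ (sum (f ∘ suc)) (sum (g ∘ suc)) ⟩
  sum f - sum g ∎
  where
  open ≡-Reasoning
  f₀ = f zero
  g₀ = g zero

∑-nonNeg : ∀ {n} (f : Fin n → ℚ) → (∀ i → 0ℚ ≤ f i) → 0ℚ ≤ sum f
∑-nonNeg {zero}  f f≥0 = ≤-refl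
∑-nonNeg {suc n} f f≥0 = +-mono-≤ (f≥0 zero) (∑-nonNeg (f ∘ suc) (f≥0 ∘ suc))

term≤∑ : ∀ {n} (f : Fin n → ℚ) → (∀ i → 0ℚ ≤ f i) → ∀ i → f i ≤ sum f
term≤∑ f f≥0 zero    =
  subst (_≤ sum f) (+-identityʳ (f zero)) (+-monoʳ-≤ (f zero) (∑-nonNeg (f ∘ suc) (f≥0 ∘ suc)))
term≤∑ f f≥0 (suc i) =
  subst (_≤ sum f) (+-identityˡ (f (suc i))) (+-mono-≤ (f≥0 zero) (term≤∑ (f ∘ suc) (f≥0 ∘ suc) i))

-- Each term is squeezed between 0 and the whole sum.
∑≡0⇒term≡0 : ∀ {n} (f : Fin n → ℚ) → (∀ i → 0ℚ ≤ f i) → sum f ≡ 0ℚ → ∀ i → f i ≡ 0ℚ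
∑≡0⇒term≡0 f f≥0 ∑f≡0 i = ≤-antisym (subst (f i ≤_) ∑f≡0 (term≤∑ f f≥0 i)) (f≥0 i)

∑-I : ∀ {n} i (f : Fin n → ℚ) → ∑[ j < n ] (I i j * f j) ≡ f i
∑-I {suc n} zero f = begin
  1ℚ * f zero + ∑[ j < n ] (0ℚ * f (suc j))
    ≡⟨ cong (λ s → 1ℚ * f zero + s) (*-distribˡ-sum 0ℚ (f ∘ suc)) ⟨
  1ℚ * f zero + 0ℚ * sum (f ∘ suc)
    ≡⟨ solve 2 (λ a b → con 1ℚ :* a :+ con 0ℚ :* b := a) refl (f zero) (sum (f ∘ suc)) ⟩
  f zero ∎
  where open ≡-Reasoning
∑-I {suc n} (suc i) f = begin
  -- `I (suc i) (suc j)` reduces to `I i j`, so the tail is the same sum one size smaller.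
  0ℚ * f zero + ∑[ j < n ] (I i j * f (suc j))
    ≡⟨ cong (λ s → 0ℚ * f zero + s) (∑-I i (f ∘ suc)) ⟩
  0ℚ * f zero + f (suc i)
    ≡⟨ solve 2 (λ a b → con 0ℚ :* a :+ b := b) refl (f zero) (f (suc i)) ⟩
  f (suc i) ∎
  where open ≡-Reasoning

I-refl : ∀ {n} (i : Fin n) → I i i ≡ 1ℚ
I-refl i = cong (if_then 1ℚ else 0ℚ) (dec-true (i ≟ᶠ i) refl)

-- The weight `f` makes this cover the degree matrix as well as `I` itself: off the diagonal both
-- sides vanish, on it the indices agree.
*-I-sym : ∀ {n} (f : Fin n → ℚ) i j → f i * I i j ≡ f j * I j i
*-I-sym f i j with i ≟ᶠ j | j ≟ᶠ i
... | yes refl | yes _    = refl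
... | yes refl | no i≢i   = contradiction refl i≢i
... | no i≢i   | yes refl = contradiction refl i≢i
... | no _     | no _     = trans (*-zeroʳ (f i)) (sym (*-zeroʳ (f j)))

-- Matrices acting on vectors, and transposes of Moore-Penrose inverses.

infixr 7 _·ᵥ_

-- `(A ⊗ B) i j` is definitionally `A` applied to column `j` of `B`, so every fact about this action
-- applies to matrix products too.
_·ᵥ_ : ∀ {n} → Matrix n → (Fin n → ℚ) → Fin n → ℚ
_·ᵥ_ {n} A v i = ∑[ k < n ] (A i k * v k)

module _ {n : ℕ} where

  ·ᵥ-congˡ : ∀ {A B : Matrix n} v → A ≋ B → ∀ i → (A ·ᵥ v) i ≡ (B ·ᵥ v) i
  ·ᵥ-congˡ v A≋B i = sum-cong-≗ (λ k → cong (_* v k) (A≋B i k))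

  ·ᵥ-congʳ : ∀ (A : Matrix n) {v w} → v ≗ w → A ·ᵥ v ≗ A ·ᵥ w
  ·ᵥ-congʳ A v≗w i = sum-cong-≗ (λ k → cong (A i k *_) (v≗w k))

  ·ᵥ-distrib-- : ∀ (A : Matrix n) v w i →
                 (A ·ᵥ (λ k → v k - w k)) i ≡ (A ·ᵥ v) i - (A ·ᵥ w) i
  ·ᵥ-distrib-- A v w i = trans
    (sum-cong-≗ (λ k → solve 3 (λ a x y → a :* (x :- y) := a :* x :- a :* y) refl (A i k) (v k) (w k)))
    (∑-distrib-- (λ k → A i k * v k) (λ k → A i k * w k))

  ⊗-·ᵥ-assoc : ∀ (A B : Matrix n) v → (A ⊗ B) ·ᵥ v ≗ A ·ᵥ B ·ᵥ v
  ⊗-·ᵥ-assoc A B v i = begin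
    ∑[ l < n ] (∑[ k < n ] (A i k * B k l) * v l)
      ≡⟨ sum-cong-≗ (λ l → *-distribʳ-sum (v l) (λ k → A i k * B k l)) ⟩
    ∑[ l < n ] ∑[ k < n ] (A i k * B k l * v l)
      ≡⟨ ∑-comm (λ l k → A i k * B k l * v l) ⟩
    ∑[ k < n ] ∑[ l < n ] (A i k * B k l * v l)
      ≡⟨ sum-cong-≗ (λ k → trans
           (sum-cong-≗ (λ l → *-assoc (A i k) (B k l) (v l)))
           (sym (*-distribˡ-sum (A i k) (λ l → B k l * v l)))) ⟩
    ∑[ k < n ] (A i k * ∑[ l < n ] (B k l * v l)) ∎
    where open ≡-Reasoning

  ⊗-assoc : ∀ (A B C : Matrix n) → (A ⊗ B) ⊗ C ≋ A ⊗ (B ⊗ C)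
  ⊗-assoc A B C i j = ⊗-·ᵥ-assoc A B (λ k → C k j) i

  module _ {A X : Matrix n} (A-sym : A ᵀ ≋ A) (mp : IsMoorePenroseInverse A X) where
    open IsMoorePenroseInverse mp
    open ≡-Reasoning

    A⊗Xᵀ≋[X⊗A]ᵀ : A ⊗ (X ᵀ) ≋ (X ⊗ A) ᵀ
    A⊗Xᵀ≋[X⊗A]ᵀ i j = sum-cong-≗ λ k →
      trans (*-comm (A i k) (X j k)) (cong (X j k *_) (A-sym k i))

    Xᵀ⊗A≋[A⊗X]ᵀ : (X ᵀ) ⊗ A ≋ (A ⊗ X) ᵀ
    Xᵀ⊗A≋[A⊗X]ᵀ i j = sum-cong-≗ λ k →
      trans (*-comm (X k i) (A k j)) (cong (_* X k i) (A-sym j k))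

    -- For symmetric `A`, transposition preserves the first two Penrose equations and interchanges
    -- the last two. This carries facts about the columns of `X` over to its rows.
    ᵀ-isMoorePenroseInverse : IsMoorePenroseInverse A (X ᵀ)
    ᵀ-isMoorePenroseInverse = record
      { AXA≋A = λ i j → begin
          (A ⊗ X ᵀ ⊗ A) i j      ≡⟨ ·ᵥ-congˡ (λ k → A k j) A⊗Xᵀ≋[X⊗A]ᵀ i ⟩
          ((X ⊗ A) ᵀ ⊗ A) i j    ≡⟨ sum-cong-≗ (λ k → trans (*-comm ((X ⊗ A) k i) (A k j))
                                      (cong (_* (X ⊗ A) k i) (A-sym j k))) ⟩
          (A ⊗ (X ⊗ A)) j i      ≡⟨ ⊗-assoc A X A j i ⟨
          (A ⊗ X ⊗ A) j i        ≡⟨ AXA≋A j i ⟩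
          A j i                  ≡⟨ A-sym i j ⟩
          A i j                  ∎
      ; XAX≋X = λ i j → begin
          (X ᵀ ⊗ A ⊗ X ᵀ) i j    ≡⟨ ·ᵥ-congˡ (λ k → X j k) Xᵀ⊗A≋[A⊗X]ᵀ i ⟩
          ((A ⊗ X) ᵀ ⊗ X ᵀ) i j  ≡⟨ sum-cong-≗ (λ k → *-comm ((A ⊗ X) k i) (X j k)) ⟩
          (X ⊗ (A ⊗ X)) j i      ≡⟨ ⊗-assoc X A X j i ⟨
          (X ⊗ A ⊗ X) j i        ≡⟨ XAX≋X j i ⟩
          X j i                  ∎
      ; AX-sym = λ i j → begin
          (A ⊗ X ᵀ) j i  ≡⟨ A⊗Xᵀ≋[X⊗A]ᵀ j i ⟩
          (X ⊗ A) i j    ≡⟨ XA-sym j i ⟩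
          (X ⊗ A) j i    ≡⟨ A⊗Xᵀ≋[X⊗A]ᵀ i j ⟨
          (A ⊗ X ᵀ) i j  ∎
      ; XA-sym = λ i j → begin
          (X ᵀ ⊗ A) j i  ≡⟨ Xᵀ⊗A≋[A⊗X]ᵀ j i ⟩
          (A ⊗ X) i j    ≡⟨ AX-sym j i ⟩
          (A ⊗ X) j i    ≡⟨ Xᵀ⊗A≋[A⊗X]ᵀ i j ⟨
          (X ᵀ ⊗ A) i j  ∎
      }

-- Sums over neighbourhoods and the Laplacian of a graph.

sumOver-const : ∀ {n} (S : Subset n) x → ∑[ j ∈ S ] x ≡ fromℕ ∣ S ∣ * x
sumOver-const []          x = sym (*-zeroˡ x)
sumOver-const (false ∷ S) x = trans (+-identityˡ _) (sumOver-const S x)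
sumOver-const (true  ∷ S) x = begin
  x + ∑[ j ∈ S ] x         ≡⟨ cong (λ s → x + s) (sumOver-const S x) ⟩
  x + fromℕ ∣ S ∣ * x      ≡⟨ solve 2 (λ m x → x :+ m :* x := (con 1ℚ :+ m) :* x) refl (fromℕ ∣ S ∣) x ⟩
  (1ℚ + fromℕ ∣ S ∣) * x   ≡⟨ cong (_* x) (fromℕ-suc ∣ S ∣) ⟨
  fromℕ (suc ∣ S ∣) * x    ∎
  where open ≡-Reasoning

module _ {n} (G : Graph n) where
  open Graph G using (Adj; _adj?_; adj-sym)
  open ≡-Reasoning

  private
    L = laplacian G
    A = adjacency G
    δ : Fin n → ℚ
    δ i = fromℕ (degree G i)

  adjacency-sym : A ᵀ ≋ A
  adjacency-sym i j =
    cong (if_then 1ℚ else 0ℚ) (does-⇔ (mk⇔ adj-sym adj-sym) (j adj? i) (i adj? j))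

  laplacian-sym : L ᵀ ≋ L
  laplacian-sym i j = cong₂ _-_ (*-I-sym δ j i) (adjacency-sym i j)

  sumOver-N : ∀ i f → ∑[ j ∈ N G i ] f j ≡ (A ·ᵥ f) i
  sumOver-N i f = sum-cong-≗ λ j → trans
    (cong (if_then f j else 0ℚ) (lookup∘tabulate _ j))
    (if-then-0 (does (i adj? j)) (f j))
    where
    if-then-0 : ∀ b x → (if b then x else 0ℚ) ≡ (if b then 1ℚ else 0ℚ) * x
    if-then-0 true  x = sym (*-identityˡ x)
    if-then-0 false x = sym (*-zeroˡ x)

  laplacian-·ᵥ : ∀ v i → (L ·ᵥ v) i ≡ δ i * v i - (A ·ᵥ v) i
  laplacian-·ᵥ v i = begin
    ∑[ j < n ] ((δ i * I i j - A i j) * v j)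
      ≡⟨ sum-cong-≗ (λ j → solve 4 (λ d x a y → (d :* x :- a) :* y := d :* (x :* y) :- a :* y)
           refl (δ i) (I i j) (A i j) (v j)) ⟩
    ∑[ j < n ] (δ i * (I i j * v j) - A i j * v j)
      ≡⟨ ∑-distrib-- (λ j → δ i * (I i j * v j)) (λ j → A i j * v j) ⟩
    ∑[ j < n ] (δ i * (I i j * v j)) - (A ·ᵥ v) i
      ≡⟨ cong (_- (A ·ᵥ v) i) (*-distribˡ-sum (δ i) (λ j → I i j * v j)) ⟨
    δ i * ∑[ j < n ] (I i j * v j) - (A ·ᵥ v) i
      ≡⟨ cong (λ x → δ i * x - (A ·ᵥ v) i) (∑-I i v) ⟩
    δ i * v i - (A ·ᵥ v) i ∎

  A-·ᵥ-const : ∀ i x → (A ·ᵥ (λ _ → x)) i ≡ δ i * x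
  A-·ᵥ-const i x = trans (sym (sumOver-N i (λ _ → x))) (sumOver-const (N G i) x)

  laplacian-·ᵥ-const : ∀ x i → (L ·ᵥ (λ _ → x)) i ≡ 0ℚ
  laplacian-·ᵥ-const x i = begin
    (L ·ᵥ (λ _ → x)) i              ≡⟨ laplacian-·ᵥ (λ _ → x) i ⟩
    δ i * x - (A ·ᵥ (λ _ → x)) i    ≡⟨ cong (λ y → δ i * x - y) (A-·ᵥ-const i x) ⟩
    δ i * x - δ i * x               ≡⟨ +-inverseʳ (δ i * x) ⟩
    0ℚ                              ∎

  -- The term `δ i * v i` is `v i` summed over the neighbours of `i`. This translates Kirchhoff's
  -- current law into an equation for the Laplacian.
  laplacian-·ᵥ-net-current : ∀ v i → (L ·ᵥ v) i ≡ ∑[ j ∈ N G i ] (v i - v j)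
  laplacian-·ᵥ-net-current v i = begin
    (L ·ᵥ v) i                              ≡⟨ laplacian-·ᵥ v i ⟩
    δ i * v i - (A ·ᵥ v) i                  ≡⟨ cong (_- (A ·ᵥ v) i) (A-·ᵥ-const i (v i)) ⟨
    (A ·ᵥ (λ _ → v i)) i - (A ·ᵥ v) i       ≡⟨ ·ᵥ-distrib-- A (λ _ → v i) v i ⟨
    (A ·ᵥ (λ j → v i - v j)) i              ≡⟨ sumOver-N i (λ j → v i - v j) ⟨
    ∑[ j ∈ N G i ] (v i - v j)              ∎

  A-nonNeg : ∀ i j {x} → 0ℚ ≤ x → 0ℚ ≤ A i j * x
  A-nonNeg i j {x} 0≤x with does (i adj? j)
  ... | true  = subst (0ℚ ≤_) (sym (*-identityˡ x)) 0≤x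
  ... | false = ≤-reflexive (sym (*-zeroˡ x))

  -- A vanishing sum of nonnegative terms has only zero terms, and the term at a neighbour has
  -- coefficient 1.
  A-·ᵥ≡0⇒≡0 : ∀ {i j} v → (∀ k → 0ℚ ≤ v k) → (A ·ᵥ v) i ≡ 0ℚ → Adj i j → v j ≡ 0ℚ
  A-·ᵥ≡0⇒≡0 {i} {j} v v≥0 Av≡0 i~j = begin
    v j          ≡⟨ *-identityˡ (v j) ⟨
    1ℚ * v j     ≡⟨ cong (λ b → (if b then 1ℚ else 0ℚ) * v j) (dec-true (i adj? j) i~j) ⟨
    A i j * v j  ≡⟨ ∑≡0⇒term≡0 (λ k → A i k * v k) (λ k → A-nonNeg i k (v≥0 k)) Av≡0 j ⟩
    0ℚ           ∎

  -- The adjacency matrix sends the constant vector 1 to the degrees, so a zero degree at `i` would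
  -- force 1 to equal 0 at the neighbour.
  degree≢0 : ∀ {i j} → Adj i j → δ i ≢ 0ℚ
  degree≢0 {i} i~j δ≡0 = contradiction
    (A-·ᵥ≡0⇒≡0 (λ _ → 1ℚ) (λ _ → nonNegative⁻¹ 1ℚ)
      (trans (A-·ᵥ-const i 1ℚ) (trans (*-identityʳ (δ i)) δ≡0)) i~j)
    λ ()

  -- The maximum principle on a connected graph.

  module _ (connected : Connected G) where

    -- Where `v` is maximal, the drops to the neighbours are nonnegative and sum to `(L ·ᵥ v) k`,
    -- which is 0. So all neighbours attain the maximum as well, and connectedness spreads it to
    -- every vertex.
    harmonic⇒constant : ∀ v → (∀ i → (L ·ᵥ v) i ≡ 0ℚ) → ∀ i j → v i ≡ v j
    harmonic⇒constant v Lv≡0 i j = trans (sym (from-max i)) (from-max j)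
      where
      -- `argmax` needs a default vertex, for which `i` serves; `allFin n` already lists all
      -- vertices.
      m = argmax v i (allFin n)

      propagate : ∀ {k l} → (∀ x → v x ≤ v k) → Star Adj k l → v k ≡ v l
      propagate             max ε          = refl
      propagate {k} {l} max (_◅_ {j = h} k~h h⋯l) =
        -- Since `v h` equals the maximum `v k`, the maximality hypothesis passes to `h` and the
        -- rest of the walk.
        trans vk≡vh (propagate (λ x → subst (v x ≤_) vk≡vh (max x)) h⋯l)
        where
        vk-vh≡0 : v k - v h ≡ 0ℚ
        vk-vh≡0 = A-·ᵥ≡0⇒≡0 (λ x → v k - v x) (λ x → p≤q⇒0≤q-p (max x))
          (trans (sym (sumOver-N k (λ x → v k - v x)))
            (trans (sym (laplacian-·ᵥ-net-current v k)) (Lv≡0 k)))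
          k~h

        vk≡vh : v k ≡ v h
        vk≡vh = p-q≡0⇒p≡q (v k) (v h) vk-vh≡0

      from-max : ∀ k → v m ≡ v k
      from-max k = propagate
        (λ x → All.lookup (f[xs]≤f[argmax] i (allFin n)) (∈-allFin x)) (connected m k)

    -- The Moore-Penrose inverse of the Laplacian.

    module _ .{{_ : NonZero n}} where

      private
        1/n = + 1 / n

      -- `P`, the difference of `I` and `X ⊗ L`, is the orthogonal projection onto the kernel of
      -- `L`. Its columns are harmonic, hence constant; by symmetry all its entries are equal. Each
      -- row sums to 1 because `L` kills constants, so every entry is `1/n`.
      L⁺L≋I-J/n : ∀ {X} → IsMoorePenroseInverse L X → ∀ i j → (X ⊗ L) i j ≡ I i j - 1/n
      L⁺L≋I-J/n {X} mp i j = begin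
        (X ⊗ L) i j               ≡⟨ solve 2 (λ x y → x := y :- (y :- x)) refl ((X ⊗ L) i j) (I i j) ⟩
        I i j - P i j             ≡⟨ cong (λ x → I i j - x) P≡1/n ⟩
        I i j - 1/n               ∎
        where
        open IsMoorePenroseInverse mp

        P : Matrix n
        P i j = I i j - (X ⊗ L) i j

        I-sym : ∀ i j → I i j ≡ I j i
        I-sym i j = trans (sym (*-identityˡ (I i j)))
          (trans (*-I-sym (λ _ → 1ℚ) i j) (*-identityˡ (I j i)))

        P-sym : ∀ i j → P i j ≡ P j i
        P-sym i j = cong₂ _-_ (I-sym i j) (XA-sym j i)

        LI≡L : ∀ i j → (L ·ᵥ (λ k → I k j)) i ≡ L i j
        LI≡L i j = trans
          (sum-cong-≗ (λ k → trans (*-comm (L i k) (I k j)) (cong (_* L i k) (I-sym k j))))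
          (∑-I j (L i))

        LP≡0 : ∀ j i → (L ·ᵥ (λ k → P k j)) i ≡ 0ℚ
        LP≡0 j i = begin
          (L ·ᵥ (λ k → P k j)) i
            ≡⟨ ·ᵥ-distrib-- L (λ k → I k j) (λ k → (X ⊗ L) k j) i ⟩
          (L ·ᵥ (λ k → I k j)) i - (L ⊗ (X ⊗ L)) i j
            ≡⟨ cong₂ _-_ (LI≡L i j) (trans (sym (⊗-assoc L X L i j)) (AXA≋A i j)) ⟩
          L i j - L i j
            ≡⟨ +-inverseʳ (L i j) ⟩
          0ℚ ∎

        -- Constancy of columns only moves the row index; symmetry in between lets it move the
        -- column index too.
        P-constant : ∀ k → P i k ≡ P i j
        P-constant k = begin
          P i k  ≡⟨ harmonic⇒constant (λ l → P l k) (LP≡0 k) i j ⟩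
          P j k  ≡⟨ P-sym j k ⟩
          P k j  ≡⟨ harmonic⇒constant (λ l → P l j) (LP≡0 j) k i ⟩
          P i j  ∎

        ∑≡∑*1 : ∀ (f : Fin n → ℚ) → sum f ≡ ∑[ k < n ] (f k * 1ℚ)
        ∑≡∑*1 f = sum-cong-≗ (λ k → sym (*-identityʳ (f k)))

        ∑P≡1 : sum (P i) ≡ 1ℚ
        ∑P≡1 = begin
          ∑[ k < n ] (I i k - (X ⊗ L) i k)
            ≡⟨ ∑-distrib-- (I i) ((X ⊗ L) i) ⟩
          sum (I i) - sum ((X ⊗ L) i)
            ≡⟨ cong₂ _-_ (trans (∑≡∑*1 (I i)) (∑-I i (λ _ → 1ℚ))) (∑≡∑*1 ((X ⊗ L) i)) ⟩
          1ℚ - ((X ⊗ L) ·ᵥ (λ _ → 1ℚ)) i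
            ≡⟨ cong (λ x → 1ℚ - x) (⊗-·ᵥ-assoc X L (λ _ → 1ℚ) i) ⟩
          1ℚ - (X ·ᵥ L ·ᵥ (λ _ → 1ℚ)) i
            ≡⟨ cong (λ x → 1ℚ - x) (·ᵥ-congʳ X (laplacian-·ᵥ-const 1ℚ) i) ⟩
          1ℚ - ∑[ k < n ] (X i k * 0ℚ)
            ≡⟨ cong (λ x → 1ℚ - x) (*-distribʳ-sum 0ℚ (X i)) ⟨
          1ℚ - sum (X i) * 0ℚ
            ≡⟨ solve 1 (λ x → con 1ℚ :- x :* con 0ℚ := con 1ℚ) refl (sum (X i)) ⟩
          1ℚ ∎

        P≡1/n : P i j ≡ 1/n
        P≡1/n = begin
          P i j                    ≡⟨ constant⇒≡average (P i) (P i j) P-constant ⟩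
          1/n * sum (P i)          ≡⟨ cong (1/n *_) ∑P≡1 ⟩
          1/n * 1ℚ                 ≡⟨ *-identityʳ 1/n ⟩
          1/n                      ∎

      -- Thus `X` recovers `v` from `L ·ᵥ v` up to an additive constant, the mean of `v`.
      L⁺L-·ᵥ : ∀ {X} → IsMoorePenroseInverse L X →
               ∀ v i → ((X ⊗ L) ·ᵥ v) i ≡ v i - 1/n * sum v
      L⁺L-·ᵥ {X} mp v i = begin
        ((X ⊗ L) ·ᵥ v) i
          ≡⟨ sum-cong-≗ (λ k → trans (cong (_* v k) (L⁺L≋I-J/n mp i k))
               (solve 3 (λ a b c → (a :- b) :* c := a :* c :- b :* c) refl (I i k) 1/n (v k))) ⟩
        ∑[ k < n ] (I i k * v k - 1/n * v k)
          ≡⟨ ∑-distrib-- (λ k → I i k * v k) (λ k → 1/n * v k) ⟩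
        ∑[ k < n ] (I i k * v k) - ∑[ k < n ] (1/n * v k)
          ≡⟨ cong₂ _-_ (∑-I i v) (sym (*-distribˡ-sum 1/n v)) ⟩
        v i - 1/n * sum v ∎

      -- X = (XL)X = (I - J/n)X, so JX = 0.
      L⁺-column-sum : ∀ {X} → IsMoorePenroseInverse L X → ∀ j → ∑[ i < n ] X i j ≡ 0ℚ
      L⁺-column-sum {X} mp j = begin
        c                                ≡⟨ *-identityˡ c ⟨
        1ℚ * c                           ≡⟨ cong (_* c) (n*1/n≡1 n) ⟨
        fromℕ n * 1/n * c                ≡⟨ *-assoc (fromℕ n) 1/n c ⟩
        fromℕ n * (1/n * c)              ≡⟨ ∑-const n (1/n * c) ⟨
        ∑[ i < n ] (1/n * c)             ≡⟨ sum-cong-≗ step ⟩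
        ∑[ i < n ] (X i j - X i j)       ≡⟨ ∑-distrib-- (λ i → X i j) (λ i → X i j) ⟩
        c - c                            ≡⟨ +-inverseʳ c ⟩
        0ℚ                               ∎
        where
        c = ∑[ i < n ] X i j
        step : ∀ i → 1/n * c ≡ X i j - X i j
        step i = begin
          1/n * c                        ≡⟨ solve 2 (λ x y → y := x :- (x :- y)) refl (X i j) (1/n * c) ⟩
          X i j - (X i j - 1/n * c)      ≡⟨ cong (λ x → X i j - x) (L⁺L-·ᵥ mp (λ k → X k j) i) ⟨
          X i j - (X ⊗ L ⊗ X) i j        ≡⟨ cong (λ x → X i j - x) (IsMoorePenroseInverse.XAX≋X mp i j) ⟩
          X i j - X i j                  ∎

      module _ {X : Matrix n} (mp : IsMoorePenroseInverse L X) where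

        L⁺-row-sum : ∀ i → sum (X i) ≡ 0ℚ
        L⁺-row-sum = L⁺-column-sum (ᵀ-isMoorePenroseInverse laplacian-sym mp)

        sumOver-N-L⁺ : ∀ i → ∑[ j ∈ N G i ] X i j ≡ δ i * X i i + 1/n - 1ℚ
        sumOver-N-L⁺ i = begin
          ∑[ j ∈ N G i ] X i j
            ≡⟨ sumOver-N i (X i) ⟩
          (A ·ᵥ X i) i
            ≡⟨ solve 2 (λ d a → a := d :- (d :- a)) refl (δ i * X i i) ((A ·ᵥ X i) i) ⟩
          δ i * X i i - (δ i * X i i - (A ·ᵥ X i) i)
            ≡⟨ cong (λ x → δ i * X i i - x) (laplacian-·ᵥ (X i) i) ⟨
          δ i * X i i - (L ·ᵥ X i) i
            -- Symmetry of `L` turns `L` applied to row `i` of `X` into a diagonal entry of `X ⊗ L`.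
            ≡⟨ cong (λ x → δ i * X i i - x) (sum-cong-≗ (λ k →
                 trans (*-comm (L i k) (X i k)) (cong (X i k *_) (laplacian-sym k i)))) ⟩
          δ i * X i i - (X ⊗ L) i i
            ≡⟨ cong (λ x → δ i * X i i - x) (L⁺L≋I-J/n mp i i) ⟩
          δ i * X i i - (I i i - 1/n)
            ≡⟨ cong (λ x → δ i * X i i - (x - 1/n)) (I-refl i) ⟩
          δ i * X i i - (1ℚ - 1/n)
            ≡⟨ solve 2 (λ d c → d :- (con 1ℚ :- c) := d :+ c :- con 1ℚ) refl (δ i * X i i) 1/n ⟩
          δ i * X i i + 1/n - 1ℚ ∎

        -- Potentials and effective resistances in terms of `X`.

        -- Kirchhoff's law says that `L ·ᵥ v` is the difference of two unit vectors. Applying `X`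
        -- yields two columns of `X` on one side and `v` without its mean on the other.
        unitFlowPotential : ∀ {i j v} → IsUnitFlowPotential G i j v →
                            ∀ k → v k ≡ X k i - X k j + 1/n * sum v
        unitFlowPotential {i} {j} {v} flow k = begin
          v k
            ≡⟨ solve 2 (λ x y → x := x :- y :+ y) refl (v k) (1/n * sum v) ⟩
          v k - 1/n * sum v + 1/n * sum v
            ≡⟨ cong (_+ 1/n * sum v) (L⁺L-·ᵥ mp v k) ⟨
          ((X ⊗ L) ·ᵥ v) k + 1/n * sum v
            ≡⟨ cong (_+ 1/n * sum v) (⊗-·ᵥ-assoc X L v k) ⟩
          (X ·ᵥ L ·ᵥ v) k + 1/n * sum v
            ≡⟨ cong (_+ 1/n * sum v) (·ᵥ-congʳ X
                 (λ l → trans (laplacian-·ᵥ-net-current v l) (flow l)) k) ⟩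
          (X ·ᵥ (λ l → I i l - I j l)) k + 1/n * sum v
            ≡⟨ cong (_+ 1/n * sum v) (·ᵥ-distrib-- X (I i) (I j) k) ⟩
          (X ·ᵥ I i) k - (X ·ᵥ I j) k + 1/n * sum v
            ≡⟨ cong (_+ 1/n * sum v) (cong₂ _-_ (X-column i) (X-column j)) ⟩
          X k i - X k j + 1/n * sum v ∎
          where
          X-column : ∀ i → (X ·ᵥ I i) k ≡ X k i
          X-column i = trans (sum-cong-≗ (λ l → *-comm (X k l) (I i l))) (∑-I i (X k))

        -- The mean of `v` cancels in `v i - v j`. The entries `X i j` and `X j i` stay apart:
        -- summed over `j`, one gives a row sum and the other a column sum of `X`, both zero.
        effectiveResistance : ∀ {i j r} → IsEffectiveResistance G i j r →
                              r ≡ (X i i + X j j) - (X i j + X j i)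
        effectiveResistance {i} {j} {r} (v , flow , r≡) = begin
          r
            ≡⟨ r≡ ⟩
          v i - v j
            ≡⟨ cong₂ _-_ (unitFlowPotential flow i) (unitFlowPotential flow j) ⟩
          (X i i - X i j + m) - (X j i - X j j + m)
            ≡⟨ solve 5 (λ a b c d m → (a :- b :+ m) :- (c :- d :+ m) := (a :+ d) :- (b :+ c))
                 refl (X i i) (X i j) (X j i) (X j j) m ⟩
          (X i i + X j j) - (X i j + X j i) ∎
          where m = 1/n * sum v

        private
          tr : ℚ
          tr = ∑[ k < n ] X k k

        -- Row sums of the resistance matrix and the Kirchhoff index.

        module _ {R : Matrix n} (isR : IsResistanceMatrix G R) where

          resistance-row-sum : ∀ i → sum (R i) ≡ fromℕ n * X i i + tr
          resistance-row-sum i = begin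
            sum (R i)
              ≡⟨ sum-cong-≗ (λ j → effectiveResistance (isR i j)) ⟩
            ∑[ j < n ] ((X i i + X j j) - (X i j + X j i))
              ≡⟨ ∑-distrib-- (λ j → X i i + X j j) (λ j → X i j + X j i) ⟩
            ∑[ j < n ] (X i i + X j j) - ∑[ j < n ] (X i j + X j i)
              ≡⟨ cong₂ _-_ (∑-distrib-+ (λ _ → X i i) (λ j → X j j)) (∑-distrib-+ (X i) (λ j → X j i)) ⟩
            (∑[ j < n ] X i i + tr) - (sum (X i) + ∑[ j < n ] X j i)
              ≡⟨ cong₂ (λ x y → (x + tr) - y) (∑-const n (X i i))
                   (cong₂ _+_ (L⁺-row-sum i) (L⁺-column-sum mp i)) ⟩
            (fromℕ n * X i i + tr) - 0ℚ
              ≡⟨ +-identityʳ _ ⟩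
            fromℕ n * X i i + tr ∎

          -- Summed over `i`, both parts of the row sum contribute `fromℕ n * tr`, and the factor ½
          -- leaves one copy.
          kirchhoffIndex≡n*tr : kirchhoffIndex R ≡ fromℕ n * tr
          kirchhoffIndex≡n*tr = begin
            ½ * ∑[ i < n ] sum (R i)
              ≡⟨ cong (½ *_) (sum-cong-≗ resistance-row-sum) ⟩
            ½ * ∑[ i < n ] (fromℕ n * X i i + tr)
              ≡⟨ cong (½ *_) (∑-distrib-+ (λ i → fromℕ n * X i i) (λ _ → tr)) ⟩
            ½ * (∑[ i < n ] (fromℕ n * X i i) + ∑[ i < n ] tr)
              ≡⟨ cong (½ *_) (cong₂ _+_ (sym (*-distribˡ-sum (fromℕ n) (λ i → X i i))) (∑-const n tr)) ⟩
            ½ * (fromℕ n * tr + fromℕ n * tr)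
              ≡⟨ solve 1 (λ x → con ½ :* (x :+ x) := x) refl (fromℕ n * tr) ⟩
            fromℕ n * tr ∎

          -- Identifies the first term of the criterion as `d` times the mean of the diagonal of
          -- `X`.
          d/n²*kirchhoffIndex : ∀ d →
            _/_ (+ d) (n ^ 2) {{m^n≢0 n 2}} * kirchhoffIndex R ≡ fromℕ d * (1/n * tr)
          d/n²*kirchhoffIndex d = begin
            _/_ (+ d) (n ^ 2) {{m^n≢0 n 2}} * kirchhoffIndex R
              ≡⟨ cong₂ _*_ (d/n²≡d*1/n*1/n d n) kirchhoffIndex≡n*tr ⟩
            fromℕ d * (1/n * 1/n) * (fromℕ n * tr)
              ≡⟨ solve 4 (λ d c m t → d :* (c :* c) :* (m :* t) := d :* (c :* (m :* c :* t)))
                   refl (fromℕ d) 1/n (fromℕ n) tr ⟩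
            fromℕ d * (1/n * (fromℕ n * 1/n * tr))
              ≡⟨ cong (λ x → fromℕ d * (1/n * (x * tr))) (n*1/n≡1 n) ⟩
            fromℕ d * (1/n * (1ℚ * tr))
              ≡⟨ cong (λ x → fromℕ d * (1/n * x)) (*-identityˡ tr) ⟩
            fromℕ d * (1/n * tr) ∎

          resistanceRegular⇒L⁺-diagonal-constant : ResistanceRegular R → ∀ i k → X i i ≡ X k k
          resistanceRegular⇒L⁺-diagonal-constant reg i k =
            *-cancelˡ-≢0 (fromℕ n) n≢0 (+-cancelʳ tr _ _ (begin
              fromℕ n * X i i + tr  ≡⟨ resistance-row-sum i ⟨
              sum (R i)             ≡⟨ reg i k ⟩
              sum (R k)             ≡⟨ resistance-row-sum k ⟩
              fromℕ n * X k k + tr  ∎))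
            where
            n≢0 : fromℕ n ≢ 0ℚ
            n≢0 n≡0 = contradiction
              (trans (sym (n*1/n≡1 n)) (trans (cong (_* 1/n) n≡0) (*-zeroˡ 1/n))) λ ()

corollary2p32 : (n d : ℕ) .{{_ : NonZero n}} (G : Graph n) →
    Connected G → Regular d G →
    (L⁺ : Matrix n) → IsMoorePenroseInverse (laplacian G) L⁺ →
    (R : Matrix n) → IsResistanceMatrix G R →
    ResistanceRegular R ⇔
    (∀ i → ∑[ j ∈ N G i ] L⁺ i j ≡
    _/_ (+ d) (n ^ 2) {{m^n≢0 n 2}} * kirchhoffIndex R + (+ 1 / n) - 1ℚ)

-- The two implications of the equivalence.

corollary2p32 n d G connected regular L⁺ mp R isR = mk⇔ to from
  where
  open ≡-Reasoning
  1/n = + 1 / n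
  mean = 1/n * ∑[ k < n ] L⁺ k k
  RHS = _/_ (+ d) (n ^ 2) {{m^n≢0 n 2}} * kirchhoffIndex R + 1/n - 1ℚ

  -- Both sides of the criterion take the form `fromℕ d * y + 1/n - 1ℚ`, where `y` is `L⁺ i i` here
  -- and `mean` in `RHS≡`.
  LHS≡ : ∀ i → ∑[ j ∈ N G i ] L⁺ i j ≡ fromℕ d * L⁺ i i + 1/n - 1ℚ
  LHS≡ i = trans (sumOver-N-L⁺ G connected mp i)
    (cong (λ m → fromℕ m * L⁺ i i + 1/n - 1ℚ) (regular i))

  RHS≡ : RHS ≡ fromℕ d * mean + 1/n - 1ℚ
  RHS≡ = cong (λ x → x + 1/n - 1ℚ) (d/n²*kirchhoffIndex G connected mp isR d)

  to : ResistanceRegular R → ∀ i → ∑[ j ∈ N G i ] L⁺ i j ≡ RHS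
  to reg i = begin
    ∑[ j ∈ N G i ] L⁺ i j           ≡⟨ LHS≡ i ⟩
    fromℕ d * L⁺ i i + 1/n - 1ℚ     ≡⟨ cong (λ x → fromℕ d * x + 1/n - 1ℚ)
                                         (constant⇒≡average (λ k → L⁺ k k) (L⁺ i i) (λ k →
                                           resistanceRegular⇒L⁺-diagonal-constant G connected mp isR reg k i)) ⟩
    fromℕ d * mean + 1/n - 1ℚ       ≡⟨ RHS≡ ⟨
    RHS                             ∎

  from : (∀ i → ∑[ j ∈ N G i ] L⁺ i j ≡ RHS) → ResistanceRegular R
  -- An empty walk means that `i` and `k` coincide. A nonempty one provides a neighbour of `i`, so
  -- `d` is nonzero and can be cancelled.
  from eq i k with connected i k
  ... | ε        = refl
  ... | i~h ◅ _  = begin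
    sum (R i)                                  ≡⟨ resistance-row-sum G connected mp isR i ⟩
    fromℕ n * L⁺ i i + ∑[ l < n ] L⁺ l l       ≡⟨ cong (λ x → fromℕ n * x + ∑[ l < n ] L⁺ l l)
                                                    (*-cancelˡ-≢0 (fromℕ d) d≢0 dLᵢ≡dLₖ) ⟩
    fromℕ n * L⁺ k k + ∑[ l < n ] L⁺ l l       ≡⟨ resistance-row-sum G connected mp isR k ⟨
    sum (R k)                                  ∎
    where
    d≢0 : fromℕ d ≢ 0ℚ
    d≢0 = subst (λ m → fromℕ m ≢ 0ℚ) (regular i) (degree≢0 G i~h)

    dLᵢ≡dLₖ : fromℕ d * L⁺ i i ≡ fromℕ d * L⁺ k k
    dLᵢ≡dLₖ = +-cancelʳ 1/n _ _ (+-cancelʳ (- 1ℚ) _ _ (begin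
      fromℕ d * L⁺ i i + 1/n - 1ℚ  ≡⟨ LHS≡ i ⟨
      ∑[ j ∈ N G i ] L⁺ i j        ≡⟨ trans (eq i) (sym (eq k)) ⟩
      ∑[ j ∈ N G k ] L⁺ k j        ≡⟨ LHS≡ k ⟩
      fromℕ d * L⁺ k k + 1/n - 1ℚ  ∎))
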